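{- Let $n\ge1$ and $m\ge 1$ be integers, let $G$ be a simple acyclic directed graph on the vertex set $[n]=\{1,\dots,n\}$, and let $h$ be the length of the longest path in $G$. Then the largest elementary divisor of $A_{\vec m,G}$ is at most $m^{h+1}$.
   Context: For a simple acyclic directed graph $G$ on $[n]$ and an integer $m$, let $\vec m=(m,m,\dots,m)$ (length $n$) and let $A_{\vec m,G}=mI_n+\sum_{(i,j)\in E(G)}E_{i,j}$, an $n\times n$ integer matrix, where $(i,j)$ denotes an edge directed from $i$ to $j$ and $E_{i,j}$ is the matrix whose only nonzero entry is a $1$ in row $i$, column $j$. A path in $G$ is a sequence of vertices $v_1\to v_2\to\dots\to v_k$ with $(v_i,v_{i+1})\in E(G)$ for $1\le i\le k-1$; its length is the number $k-1$ of edges (so the longest path has length $0$ if $G$ has no edges). The elementary divisors of a nonsingular $n\times n$ integer matrix $A$ are the positive integers $\alpha_1\mid\alpha_2\mid\dots\mid\alpha_n$ such that $\operatorname{diag}(\alpha_1,\dots,\alpha_n)$ is the Smith normal form of $A$ (entries equal to $1$ included); the largest elementary divisor is $\alpha_n$. -}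

module Defs where

open import Level using (0ℓ)
open import Data.Bool.Base using (if_then_else_; _∧_)
open import Data.Nat.Base as ℕ using (ℕ; suc; NonZero)
import Data.Nat.Divisibility as ℕ using (_∣_)
open import Data.Integer.Base using (ℤ; +_; 0ℤ; 1ℤ; _+_; _*_)
open import Data.Integer.Properties using (+-0-monoid)
open import Data.Fin.Base as Fin using (Fin)
open import Data.Fin.Properties using (_≟_)
open import Data.List.Base as List using (List; allFin; cartesianProduct; filter)
open import Data.Product.Base using (_×_; _,_; uncurry; ∃-syntax)
open import Data.Vec.Functional as Vector using (Vector)
open import Relation.Binary.Core using (Rel)
open import Relation.Binary.Definitions using (Decidable)
open import Relation.Binary.PropositionalEquality.Core using (_≡_)
open import Relation.Binary.Construct.Closure.ReflexiveTransitive using (Star; ε; _◅_)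
open import Relation.Binary.Construct.Closure.Transitive using (TransClosure)
open import Relation.Nullary.Decidable.Core using (does)
open import Relation.Nullary.Negation.Core using (¬_)
open import Algebra.Properties.Monoid.Sum +-0-monoid using (sum)
import Algebra.Definitions

-- Only the existence of a proof of i ⟶ j is ever used, so there are no
-- multiple edges.
record SimpleDigraph (n : ℕ) : Set₁ where
  infix 4 _⟶_ _⟶?_
  field
    _⟶_      : Rel (Fin n) 0ℓ
    _⟶?_     : Decidable _⟶_
    loopless : ∀ i → ¬ (i ⟶ i)

  edges : List (Fin n × Fin n)
  edges = filter (uncurry _⟶?_) (cartesianProduct (allFin n) (allFin n))

  Acyclic : Set
  Acyclic = ∀ i → ¬ TransClosure _⟶_ i i

  Path : Rel (Fin n) 0ℓ
  Path = Star _⟶_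

  -- The number of edges, not of vertices.
  pathLength : ∀ {u v} → Path u v → ℕ
  pathLength ε       = 0
  pathLength (_ ◅ p) = suc (pathLength p)

  IsLongestPathLength : ℕ → Set
  IsLongestPathLength h =
    (∃[ u ] ∃[ v ] ∃[ p ] pathLength {u} {v} p ≡ h) ×
    (∀ {u v} (p : Path u v) → pathLength p ℕ.≤ h)

Matrix : ℕ → Set
Matrix n = Vector (Vector ℤ n) n

infix  4 _≈ᴹ_
infixl 6 _+ᴹ_
infixl 7 _*ᴹ_ _·ᴹ_

_≈ᴹ_ : ∀ {n} → Rel (Matrix n) 0ℓ
A ≈ᴹ B = ∀ i j → A i j ≡ B i j

0ᴹ : ∀ {n} → Matrix n
0ᴹ i j = 0ℤ

_+ᴹ_ : ∀ {n} → Matrix n → Matrix n → Matrix n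
(A +ᴹ B) i j = A i j + B i j

_·ᴹ_ : ∀ {n} → ℤ → Matrix n → Matrix n
(c ·ᴹ A) i j = c * A i j

_*ᴹ_ : ∀ {n} → Matrix n → Matrix n → Matrix n
(A *ᴹ B) i j = sum (λ k → A i k * B k j)

diag : ∀ {n} → Vector ℤ n → Matrix n
diag d i j = if does (i ≟ j) then d i else 0ℤ

1ᴹ : ∀ {n} → Matrix n
1ᴹ = diag (λ _ → 1ℤ)

matrixUnit : ∀ {n} → Fin n → Fin n → Matrix n
matrixUnit i j k l = if does (k ≟ i) ∧ does (l ≟ j) then 1ℤ else 0ℤ

sumᴹ : ∀ {n} → List (Matrix n) → Matrix n
sumᴹ = List.foldr _+ᴹ_ 0ᴹ

graphMatrix : ∀ {n} → ℤ → SimpleDigraph n → Matrix n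
graphMatrix m G = m ·ᴹ 1ᴹ +ᴹ sumᴹ (List.map (uncurry matrixUnit) (SimpleDigraph.edges G))

-- Membership in GLₙ(ℤ): a two-sided inverse with integer entries.
Unimodular : ∀ {n} → Matrix n → Set
Unimodular = Algebra.Definitions.Invertible _≈ᴹ_ 1ᴹ _*ᴹ_

-- diag α is the Smith normal form of A.  Positivity of every entry makes this
-- satisfiable only for nonsingular A; for such A it determines α uniquely.
record IsElementaryDivisors {n} (A : Matrix n) (α : Vector ℕ n) : Set where
  field
    positive : ∀ i → NonZero (α i)
    chain    : ∀ {i j} → i Fin.≤ j → α i ℕ.∣ α j
    smith    : ∃[ U ] ∃[ V ] Unimodular U × Unimodular V ×
               U *ᴹ A *ᴹ V ≈ᴹ diag (λ i → + α i)

-- The chain condition makes the last elementary divisor the largest.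
IsLargestElementaryDivisor : ∀ {n} → Matrix (suc n) → ℕ → Set
IsLargestElementaryDivisor A d = ∃[ α ] IsElementaryDivisors A α × Vector.last α ≡ d

{-# OPTIONS --safe #-}

-- Write A = m I + N.  Paths in G have length at most h, so N^(h+1) = 0, and the
-- identities m^(k+1) N^j = A (m^k N^j) − m^k N^(j+1) yield an integer matrix B
-- with A B = m^(h+1) I.  If U A V = D is the Smith form then
-- D (V⁻¹ B U⁻¹) = m^(h+1) I, so every diagonal entry of D divides m^(h+1).
module Submission where

open import Defs
open import Data.Nat.Base using (ℕ; suc; _≤_; _^_)
open import Data.Integer.Base using (+_)

open import Data.Fin.Base using (Fin; zero; suc; fromℕ)
open import Data.Fin.Properties using (_≟_)
open import Data.Integer.Base using (ℤ; 0ℤ; 1ℤ; -1ℤ; ∣_∣; _+_; _*_)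
open import Data.Integer.Properties
  using (+-*-semiring; *-assoc; *-distribˡ-+; *-distribʳ-+; *-identityˡ;
         *-identityʳ; *-zeroˡ; *-zeroʳ; +-identityˡ; +-identityʳ; abs-*; pos-*)
open import Data.Integer.Tactic.RingSolver using (solve-∀)
open import Data.List.Base as List using (List; []; _∷_; allFin; cartesianProduct)
open import Data.List.Relation.Unary.All using (All; []; _∷_)
open import Data.List.Relation.Unary.All.Properties using (all-filter)
import Data.Nat.Base as ℕ
open import Data.Nat.Divisibility using (_∣_; divides; ∣⇒≤)
import Data.Nat.Properties as ℕ
open import Data.Product.Base using (_×_; _,_; uncurry; ∃-syntax)
open import Data.Vec.Functional using (Vector)
open import Function.Base using (_∘_)
open import Relation.Binary.Bundles using (Setoid)
open import Relation.Binary.Construct.Closure.ReflexiveTransitive using (ε; _◅_)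
open import Relation.Binary.PropositionalEquality
  using (_≡_; _≢_; refl; sym; trans; cong; cong₂; subst; module ≡-Reasoning)
import Relation.Binary.Reasoning.Setoid as SetoidReasoning
open import Relation.Nullary.Decidable.Core using (yes; no)
open import Relation.Nullary.Negation.Core using (¬_; contradiction)

open import Algebra.Properties.Semiring.Sum +-*-semiring
  using (sum; sum-syntax; sum-cong-≗; sum-replicate-zero; ∑-distrib-+; ∑-comm;
         *-distribˡ-sum; *-distribʳ-sum)

private
  variable
    n : ℕ

∑-zero : (t : Vector ℤ n) → (∀ k → t k ≡ 0ℤ) → sum t ≡ 0ℤ
∑-zero {n} t t≡0 = trans (sum-cong-≗ t≡0) (sum-replicate-zero n)

-- Matrix algebra

≈ᴹ-setoid : ℕ → Setoid _ _
≈ᴹ-setoid n = record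
  { Carrier = Matrix n
  ; _≈_ = _≈ᴹ_
  ; isEquivalence = record
    { refl  = λ _ _ → refl
    ; sym   = λ p i j → sym (p i j)
    ; trans = λ p q i j → trans (p i j) (q i j)
    }
  }

*ᴹ-congˡ : (A : Matrix n) {B C : Matrix n} → B ≈ᴹ C → A *ᴹ B ≈ᴹ A *ᴹ C
*ᴹ-congˡ A p i j = sum-cong-≗ λ k → cong (A i k *_) (p k j)

*ᴹ-congʳ : {A B : Matrix n} (C : Matrix n) → A ≈ᴹ B → A *ᴹ C ≈ᴹ B *ᴹ C
*ᴹ-congʳ C p i j = sum-cong-≗ λ k → cong (_* C k j) (p i k)

*ᴹ-assoc : (A B C : Matrix n) → A *ᴹ B *ᴹ C ≈ᴹ A *ᴹ (B *ᴹ C)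
*ᴹ-assoc {n} A B C i j = begin
  ∑[ k < n ] ((∑[ l < n ] (A i l * B l k)) * C k j)
    ≡⟨ sum-cong-≗ (λ k → *-distribʳ-sum (C k j) (λ l → A i l * B l k)) ⟩
  ∑[ k < n ] ∑[ l < n ] (A i l * B l k * C k j)
    ≡⟨ ∑-comm (λ k l → A i l * B l k * C k j) ⟩
  ∑[ l < n ] ∑[ k < n ] (A i l * B l k * C k j)
    ≡⟨ sum-cong-≗ (λ l → sum-cong-≗ λ k → *-assoc (A i l) (B l k) (C k j)) ⟩
  ∑[ l < n ] ∑[ k < n ] (A i l * (B l k * C k j))
    ≡⟨ sum-cong-≗ (λ l → *-distribˡ-sum (A i l) (λ k → B l k * C k j)) ⟨
  ∑[ l < n ] (A i l * ∑[ k < n ] (B l k * C k j)) ∎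
  where open ≡-Reasoning

*ᴹ-distribˡ : (A B C : Matrix n) → A *ᴹ (B +ᴹ C) ≈ᴹ A *ᴹ B +ᴹ A *ᴹ C
*ᴹ-distribˡ A B C i j =
  trans (sum-cong-≗ λ k → *-distribˡ-+ (A i k) (B k j) (C k j))
        (∑-distrib-+ (λ k → A i k * B k j) (λ k → A i k * C k j))

*ᴹ-distribʳ : (C A B : Matrix n) → (A +ᴹ B) *ᴹ C ≈ᴹ A *ᴹ C +ᴹ B *ᴹ C
*ᴹ-distribʳ C A B i j =
  trans (sum-cong-≗ λ k → *-distribʳ-+ (C k j) (A i k) (B i k))
        (∑-distrib-+ (λ k → A i k * C k j) (λ k → B i k * C k j))

·ᴹ-*ᴹ-assoc : (c : ℤ) (A B : Matrix n) → (c ·ᴹ A) *ᴹ B ≈ᴹ c ·ᴹ (A *ᴹ B)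
·ᴹ-*ᴹ-assoc c A B i j =
  trans (sum-cong-≗ λ k → *-assoc c (A i k) (B k j))
        (sym (*-distribˡ-sum c (λ k → A i k * B k j)))

*ᴹ-·ᴹ-comm : (A : Matrix n) (c : ℤ) (B : Matrix n) → A *ᴹ (c ·ᴹ B) ≈ᴹ c ·ᴹ (A *ᴹ B)
*ᴹ-·ᴹ-comm A c B i j =
  trans (sum-cong-≗ λ k → swap (A i k) c (B k j))
        (sym (*-distribˡ-sum c (λ k → A i k * B k j)))
  where
  swap : ∀ a c b → a * (c * b) ≡ c * (a * b)
  swap = solve-∀

-- Induction on `i` avoids a case split under the sum: `does (suc i ≟ suc k)` reduces to
-- `does (i ≟ k)`, so the tail of row `suc i` of `diag d` is by definition row `i` of
-- `diag (d ∘ suc)`.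
∑-diag : (d : Vector ℤ n) (i : Fin n) (t : Vector ℤ n) →
         sum (λ k → diag d i k * t k) ≡ d i * t i
∑-diag d zero t =
  trans (cong (λ x → d zero * t zero + x) (∑-zero _ λ k → *-zeroˡ (t (suc k)))) (+-identityʳ _)
∑-diag d (suc i) t =
  trans (cong₂ _+_ (*-zeroˡ (t zero)) (∑-diag (d ∘ suc) i (t ∘ suc))) (+-identityˡ _)

diag-diagonal : (d : Vector ℤ n) (i : Fin n) → diag d i i ≡ d i
diag-diagonal d i with i ≟ i
... | yes _   = refl
... | no  i≢i = contradiction refl i≢i

diag-*ᴹ : (d : Vector ℤ n) (B : Matrix n) → ∀ i j → (diag d *ᴹ B) i j ≡ d i * B i j
diag-*ᴹ d B i j = ∑-diag d i (λ k → B k j)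

*ᴹ-identityˡ : (A : Matrix n) → 1ᴹ *ᴹ A ≈ᴹ A
*ᴹ-identityˡ A i j = trans (diag-*ᴹ _ A i j) (*-identityˡ (A i j))

-- Multiples of a scalar plus a nilpotent matrix

infixr 8 _^ᴹ_

_^ᴹ_ : Matrix n → ℕ → Matrix n
A ^ᴹ 0     = 1ᴹ
A ^ᴹ suc k = A *ᴹ A ^ᴹ k

-- Induction on `k` with `j` free: each call lowers `k` and raises `j`, so the vanishing exponent
-- `k + j` stays fixed. The case `j = 0` produces a right multiple of `m I + N` equal to the scalar
-- matrix `m ^ k`.
scalar+nilpotent-divides : (m : ℕ) (N : Matrix n) (k j : ℕ) → N ^ᴹ (k ℕ.+ j) ≈ᴹ 0ᴹ →
  ∃[ B ] ((+ m) ·ᴹ 1ᴹ +ᴹ N) *ᴹ B ≈ᴹ (+ (m ^ k)) ·ᴹ N ^ᴹ j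
-- Here the target `N ^ᴹ j` is itself zero.
scalar+nilpotent-divides m N 0 j Nʲ≈0 = 0ᴹ , λ i l → trans
  (∑-zero _ λ k → *-zeroʳ (((+ m) ·ᴹ 1ᴹ +ᴹ N) i k))
  (sym (trans (*-identityˡ _) (Nʲ≈0 i l)))
scalar+nilpotent-divides {n} m N (suc k) j Nᵏʲ≈0 =
  let B , AB≈ = scalar+nilpotent-divides m N k (suc j)
                  (subst (λ e → N ^ᴹ e ≈ᴹ 0ᴹ) (sym (ℕ.+-suc k j)) Nᵏʲ≈0)
  -- Multiplying `A` by `c ·ᴹ X` gives the target plus the error `c ·ᴹ (N *ᴹ X)`; the inductive `B`
  -- satisfies that `A *ᴹ B` is exactly this error, so it is subtracted.
  in c ·ᴹ X +ᴹ -1ℤ ·ᴹ B , λ i l → begin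
    (A *ᴹ (c ·ᴹ X +ᴹ -1ℤ ·ᴹ B)) i l
      ≡⟨ *ᴹ-distribˡ A (c ·ᴹ X) (-1ℤ ·ᴹ B) i l ⟩
    (A *ᴹ (c ·ᴹ X)) i l + (A *ᴹ (-1ℤ ·ᴹ B)) i l
      ≡⟨ cong₂ _+_ (*ᴹ-·ᴹ-comm A c X i l) (*ᴹ-·ᴹ-comm A -1ℤ B i l) ⟩
    c * (A *ᴹ X) i l + -1ℤ * (A *ᴹ B) i l
      ≡⟨ cong₂ (λ x y → c * x + -1ℤ * y) (AX≡ i l) (AB≈ i l) ⟩
    c * (+ m * X i l + (N *ᴹ X) i l) + -1ℤ * (c * (N *ᴹ X) i l)
      ≡⟨ cancel c (+ m) (X i l) ((N *ᴹ X) i l) ⟩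
    + m * c * X i l
      ≡⟨ cong (_* X i l) (pos-* m (m ^ k)) ⟨
    + (m ^ suc k) * X i l ∎
  where
  open ≡-Reasoning
  A X : Matrix n
  A = (+ m) ·ᴹ 1ᴹ +ᴹ N
  X = N ^ᴹ j
  c : ℤ
  c = + (m ^ k)
  cancel : ∀ c m x y → c * (m * x + y) + -1ℤ * (c * y) ≡ m * c * x
  cancel = solve-∀
  AX≡ : ∀ i l → (A *ᴹ X) i l ≡ + m * X i l + (N *ᴹ X) i l
  AX≡ i l = begin
    (A *ᴹ X) i l
      ≡⟨ *ᴹ-distribʳ X ((+ m) ·ᴹ 1ᴹ) N i l ⟩
    (((+ m) ·ᴹ 1ᴹ) *ᴹ X) i l + (N *ᴹ X) i l
      ≡⟨ cong (_+ (N *ᴹ X) i l) (·ᴹ-*ᴹ-assoc (+ m) 1ᴹ X i l) ⟩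
    + m * (1ᴹ *ᴹ X) i l + (N *ᴹ X) i l
      ≡⟨ cong (λ x → + m * x + (N *ᴹ X) i l) (*ᴹ-identityˡ X i l) ⟩
    + m * X i l + (N *ᴹ X) i l ∎

-- Nilpotency of the adjacency matrix

-- All listed pairs satisfy `P`, so none of them is `(i , j)` and every summand vanishes there.
sumᴹ-matrixUnit-zero : {P : Fin n → Fin n → Set} (es : List (Fin n × Fin n)) →
  All (uncurry P) es → ∀ i j → ¬ P i j → sumᴹ (List.map (uncurry matrixUnit) es) i j ≡ 0ℤ
sumᴹ-matrixUnit-zero []             []         i j ¬Pij = refl
sumᴹ-matrixUnit-zero ((u , v) ∷ es) (Puv ∷ ps) i j ¬Pij with i ≟ u | j ≟ v
... | yes refl | yes refl = contradiction Puv ¬Pij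
... | yes _    | no _     = trans (+-identityˡ _) (sumᴹ-matrixUnit-zero es ps i j ¬Pij)
... | no _     | _        = trans (+-identityˡ _) (sumᴹ-matrixUnit-zero es ps i j ¬Pij)

module _ (G : SimpleDigraph n) where
  open SimpleDigraph G

  -- Copies the second summand of `graphMatrix`, so that `graphMatrix c G` unfolds to
  -- `c ·ᴹ 1ᴹ +ᴹ adjacency G`.
  adjacency : Matrix n
  adjacency = sumᴹ (List.map (uncurry matrixUnit) edges)

  adjacency-zero : ∀ i j → ¬ (i ⟶ j) → adjacency i j ≡ 0ℤ
  adjacency-zero = sumᴹ-matrixUnit-zero edges (all-filter (uncurry _⟶?_) (cartesianProduct (allFin n) (allFin n)))

  -- Entries of the `k`-th power count paths with `k` edges; only the vanishing half of this is
  -- proved. In each term of the product either `i ⟶ l` fails, or a path from `l` of length `k`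
  -- would extend to a forbidden one from `i`.
  adjacency^-zero : ∀ k i j → (∀ (p : Path i j) → pathLength p ≢ k) →
                    (adjacency ^ᴹ k) i j ≡ 0ℤ
  adjacency^-zero 0 i j noPath with i ≟ j
  -- The empty path excludes the diagonal entries of `1ᴹ`.
  ... | yes refl = contradiction refl (noPath ε)
  ... | no _     = refl
  adjacency^-zero (suc k) i j noPath = ∑-zero _ term
    where
    term : ∀ l → adjacency i l * (adjacency ^ᴹ k) l j ≡ 0ℤ
    term l with i ⟶? l
    ... | yes i⟶l = trans
      (cong (adjacency i l *_)
        (adjacency^-zero k l j λ p eq → noPath (i⟶l ◅ p) (cong suc eq)))
      (*-zeroʳ (adjacency i l))
    ... | no i⟶̸l = trans
      (cong (_* (adjacency ^ᴹ k) l j) (adjacency-zero i l i⟶̸l))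
      (*-zeroˡ ((adjacency ^ᴹ k) l j))

-- Divisibility of a scalar by the elementary divisors

elementaryDivisor-∣ : (A B : Matrix n) (c : ℕ) → A *ᴹ B ≈ᴹ (+ c) ·ᴹ 1ᴹ →
  (α : Vector ℕ n) → IsElementaryDivisors A α → ∀ i → α i ∣ c
elementaryDivisor-∣ {n} A B c AB≈c α isED i
  with U , V , (U⁻¹ , _ , UU⁻¹≈1) , (V⁻¹ , _ , VV⁻¹≈1) , UAV≈D ←
    IsElementaryDivisors.smith isED
  -- The cofactor is an integer; absolute values carry `entry` over to ℕ.
  = divides ∣ C i i ∣
      (trans (cong ∣_∣ entry) (trans (abs-* (+ α i) (C i i)) (ℕ.*-comm (α i) _)))
  where
  W C D : Matrix n
  W = B *ᴹ U⁻¹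
  C = V⁻¹ *ᴹ W
  D = diag (λ k → + α k)

  -- `V` cancels the leading `V⁻¹` of `C`, and `A` then meets `B`; the remaining `U⁻¹` is cancelled
  -- by `U` in `DC≈c`.
  AVC≈cU⁻¹ : A *ᴹ (V *ᴹ C) ≈ᴹ (+ c) ·ᴹ U⁻¹
  AVC≈cU⁻¹ = begin
    A *ᴹ (V *ᴹ C)           ≈⟨ *ᴹ-congˡ A (*ᴹ-assoc V V⁻¹ W) ⟨
    A *ᴹ (V *ᴹ V⁻¹ *ᴹ W)    ≈⟨ *ᴹ-congˡ A (*ᴹ-congʳ W VV⁻¹≈1) ⟩
    A *ᴹ (1ᴹ *ᴹ W)          ≈⟨ *ᴹ-congˡ A (*ᴹ-identityˡ W) ⟩
    A *ᴹ (B *ᴹ U⁻¹)         ≈⟨ *ᴹ-assoc A B U⁻¹ ⟨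
    A *ᴹ B *ᴹ U⁻¹           ≈⟨ *ᴹ-congʳ U⁻¹ AB≈c ⟩
    ((+ c) ·ᴹ 1ᴹ) *ᴹ U⁻¹    ≈⟨ ·ᴹ-*ᴹ-assoc (+ c) 1ᴹ U⁻¹ ⟩
    (+ c) ·ᴹ (1ᴹ *ᴹ U⁻¹)    ≈⟨ (λ k l → cong (+ c *_) (*ᴹ-identityˡ U⁻¹ k l)) ⟩
    (+ c) ·ᴹ U⁻¹            ∎
    where open SetoidReasoning (≈ᴹ-setoid n)

  DC≈c : D *ᴹ C ≈ᴹ (+ c) ·ᴹ 1ᴹ
  DC≈c = begin
    D *ᴹ C                  ≈⟨ *ᴹ-congʳ C UAV≈D ⟨
    U *ᴹ A *ᴹ V *ᴹ C        ≈⟨ *ᴹ-assoc (U *ᴹ A) V C ⟩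
    U *ᴹ A *ᴹ (V *ᴹ C)      ≈⟨ *ᴹ-assoc U A (V *ᴹ C) ⟩
    U *ᴹ (A *ᴹ (V *ᴹ C))    ≈⟨ *ᴹ-congˡ U AVC≈cU⁻¹ ⟩
    U *ᴹ ((+ c) ·ᴹ U⁻¹)     ≈⟨ *ᴹ-·ᴹ-comm U (+ c) U⁻¹ ⟩
    (+ c) ·ᴹ (U *ᴹ U⁻¹)     ≈⟨ (λ k l → cong (+ c *_) (UU⁻¹≈1 k l)) ⟩
    (+ c) ·ᴹ 1ᴹ             ∎
    where open SetoidReasoning (≈ᴹ-setoid n)

  entry : + c ≡ + α i * C i i
  entry = begin
    + c                     ≡⟨ *-identityʳ (+ c) ⟨
    + c * 1ℤ                ≡⟨ cong (+ c *_) (diag-diagonal _ i) ⟨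
    ((+ c) ·ᴹ 1ᴹ) i i       ≡⟨ DC≈c i i ⟨
    (D *ᴹ C) i i            ≡⟨ diag-*ᴹ (λ k → + α k) C i i ⟩
    + α i * C i i           ∎
    where open ≡-Reasoning

theorem4p4 : ∀ (n m : ℕ) → 1 ≤ m →
    (G : SimpleDigraph (suc n)) → SimpleDigraph.Acyclic G →
    (h : ℕ) → SimpleDigraph.IsLongestPathLength G h →
    (d : ℕ) → IsLargestElementaryDivisor (graphMatrix (+ m) G) d →
    d ≤ m ^ suc h
theorem4p4 n m 1≤m G _ h (_ , length≤h) d (α , isED , refl) =
  let B , AB≈ = scalar+nilpotent-divides m N (suc h) 0 N^≈0
  -- Divisibility bounds the divisor because `m ≥ 1` makes the power nonzero; `fromℕ n` is the last
  -- index.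
  in ∣⇒≤ {{ℕ.m^n≢0 m (suc h) {{ℕ.>-nonZero 1≤m}}}}
       (elementaryDivisor-∣ (graphMatrix (+ m) G) B (m ^ suc h) AB≈ α isED (fromℕ n))
  where
  N : Matrix (suc n)
  N = adjacency G
  N^≈0 : N ^ᴹ (suc h ℕ.+ 0) ≈ᴹ 0ᴹ
  -- A path with `suc h` edges would exceed the maximal length `h`.
  N^≈0 rewrite ℕ.+-identityʳ h = λ i j → adjacency^-zero G (suc h) i j
    λ p eq → ℕ.1+n≰n (subst (_≤ h) eq (length≤h p))
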